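{- Let $G$ be a doubly regular tournament with $v$ vertices and let $\Gamma$ be a transitive subtournament of size $s$ in $G$. Then $$s\le\frac{ -3+\sqrt{13+12v}}{2}.$$
   Context: A tournament is a finite digraph $G=(V,E)$ such that for any two distinct vertices $x,y$ exactly one of $(x,y)\in E$, $(y,x)\in E$ holds, and $(x,x)\notin E$ for all $x$. A vertex $x$ dominates $y$ if $(x,y)\in E$. A tournament with $v$ vertices is doubly regular if every vertex has in-degree and out-degree $(v-1)/2$ and the number of vertices dominated simultaneously by both vertices of a pair of two distinct vertices is a constant not depending on the choice of the pair (this constant is then $(v-3)/4$). A transitive tournament is a tournament such that $(x,y)\in E$ and $(y,z)\in E$ imply $(x,z)\in E$. A transitive subtournament of size $s$ in $G$ is an induced sub-digraph of $G$ on $s$ vertices which is a transitive tournament. -}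

module Defs where

open import Data.Empty using (⊥-elim)
open import Data.Fin using (Fin)
import Data.Fin.Properties as Fin
open import Data.Fin.Subset using (Subset; _∈_; _∩_; ∣_∣)
open import Data.Integer using (+_)
open import Data.Nat as ℕ using (ℕ)
open import Data.Product using (∃; _×_; _,_; proj₁)
open import Data.Rational hiding (∣_∣)
open import Data.Rational.Properties hiding (_≟_)
open import Data.Rational.Solver using (module +-*-Solver)
open import Data.Sum using (_⊎_; inj₁; inj₂)
open import Data.Vec using (tabulate)
open import Level using (0ℓ)
open import Relation.Binary using (Rel; Decidable; Transitive)
open import Relation.Binary.PropositionalEquality
open import Relation.Nullary using (¬_; yes; no; does)
open import Relation.Unary using (Pred)

-- Finiteness is not a field: it comes from the vertex type, which below is
-- Fin v or the members of a subset of Fin v.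

record IsTournament {V : Set} (E : Rel V 0ℓ) : Set where
  field
    irreflexive : ∀ x → ¬ E x x
    exactly-one : ∀ x y → x ≢ y →
                  (E x y × ¬ E y x) ⊎ (E y x × ¬ E x y)

record IsTransitiveTournament {V : Set} (E : Rel V 0ℓ) : Set where
  field
    isTournament : IsTournament E
    transitive   : Transitive E

induced : ∀ {v} → Rel (Fin v) 0ℓ → (S : Subset v) → Rel (∃ (_∈ S)) 0ℓ
induced E S x y = E (proj₁ x) (proj₁ y)

record Tournament (v : ℕ) : Set₁ where
  field
    E            : Rel (Fin v) 0ℓ
    isTournament : IsTournament E

  open IsTournament isTournament public

  E? : Decidable E
  E? x y with x Fin.≟ y
  ... | yes refl = no (irreflexive x)
  ... | no x≢y with exactly-one x y x≢y
  ...   | inj₁ (xy , _)  = yes xy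
  ...   | inj₂ (_ , ¬xy) = no ¬xy

  N⁺ : Fin v → Subset v
  N⁺ x = tabulate λ y → does (E? x y)

  N⁻ : Fin v → Subset v
  N⁻ x = tabulate λ y → does (E? y x)

  outDegree : Fin v → ℕ
  outDegree x = ∣ N⁺ x ∣

  inDegree : Fin v → ℕ
  inDegree x = ∣ N⁻ x ∣

-- A degree d equals (v - 1)/2 exactly, i.e. without rounding, when 1 + 2d = v.
record DoublyRegular {v : ℕ} (G : Tournament v) : Set where
  open Tournament G
  field
    outDegree≡      : ∀ x → 1 ℕ.+ 2 ℕ.* outDegree x ≡ v
    inDegree≡       : ∀ x → 1 ℕ.+ 2 ℕ.* inDegree x ≡ v
    commonDominated : ∃ λ k → ∀ x y → x ≢ y → ∣ N⁺ x ∩ N⁺ y ∣ ≡ k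

-- A real is a located two-sided Dedekind cut in ℚ.
record ℝ : Set₁ where
  field
    Lower Upper     : Pred ℚ 0ℓ
    lower-inhabited : ∃ Lower
    upper-inhabited : ∃ Upper
    lower-closed    : ∀ {p q} → p < q → Lower q → Lower p
    upper-closed    : ∀ {p q} → p < q → Upper p → Upper q
    lower-open      : ∀ {p} → Lower p → ∃ λ q → p < q × Lower q
    upper-open      : ∀ {q} → Upper q → ∃ λ p → p < q × Upper p
    disjoint        : ∀ {q} → Lower q → ¬ Upper q
    located         : ∀ {p q} → p < q → Lower p ⊎ Upper q

open ℝ

infix 4 _≤ᴿ_

_≤ᴿ_ : ℝ → ℝ → Set
x ≤ᴿ y = ∀ q → Lower x q → Lower y q

ℕ→ℚ : ℕ → ℚ
ℕ→ℚ n = + n / 1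

private
  q-1<q : ∀ q → q - 1ℚ < q
  q-1<q q = subst (q - 1ℚ <_) (+-identityʳ q)
              (+-monoʳ-< q {x = - 1ℚ} {y = 0ℚ} (negative⁻¹ (- 1ℚ)))

  q<q+1 : ∀ q → q < q + 1ℚ
  q<q+1 q = subst (_< q + 1ℚ) (+-identityʳ q)
              (+-monoʳ-< q {x = 0ℚ} {y = 1ℚ} (positive⁻¹ 1ℚ))

ℚ→ℝ : ℚ → ℝ
ℚ→ℝ s = record
  { Lower           = _< s
  ; Upper           = s <_
  ; lower-inhabited = s - 1ℚ , q-1<q s
  ; upper-inhabited = s + 1ℚ , q<q+1 s
  ; lower-closed    = <-trans
  ; upper-closed    = λ p<q s<p → <-trans s<p p<q
  ; lower-open      = <-dense
  ; upper-open      = λ s<q → let r , s<r , r<q = <-dense s<q in r , r<q , s<r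
  ; disjoint        = <-asym
  ; located         = loc
  }
  where
  loc : ∀ {p q} → p < q → p < s ⊎ s < q
  loc {p} p<q with p <? s
  ... | yes p<s = inj₁ p<s
  ... | no p≮s  = inj₂ (≤-<-trans (≮⇒≥ p≮s) p<q)

ℕ→ℝ : ℕ → ℝ
ℕ→ℝ n = ℚ→ℝ (ℕ→ℚ n)

private
  pullback : (f g : ℚ → ℚ) →
             (∀ {p q} → p < q → f p < f q) → (∀ {p q} → p < q → g p < g q) →
             (∀ q → f (g q) ≡ q) → (∀ q → g (f q) ≡ q) → ℝ → ℝ
  pullback f g f-mono g-mono fg gf x = record
    { Lower           = λ q → Lower x (f q)
    ; Upper           = λ q → Upper x (f q)
    ; lower-inhabited = let q , l = lower-inhabited x in
                        g q , subst (Lower x) (sym (fg q)) l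
    ; upper-inhabited = let q , u = upper-inhabited x in
                        g q , subst (Upper x) (sym (fg q)) u
    ; lower-closed    = λ p<q → lower-closed x (f-mono p<q)
    ; upper-closed    = λ p<q → upper-closed x (f-mono p<q)
    ; lower-open      = λ {p} l → let q , fp<q , lq = lower-open x l in
                        g q , subst (_< g q) (gf p) (g-mono fp<q)
                            , subst (Lower x) (sym (fg q)) lq
    ; upper-open      = λ {q} u → let p , p<fq , up = upper-open x u in
                        g p , subst (g p <_) (gf q) (g-mono p<fq)
                            , subst (Upper x) (sym (fg p)) up
    ; disjoint        = disjoint x
    ; located         = λ p<q → located x (f-mono p<q)
    }

infixl 6 _⊕_
infixl 7 _÷ᴿ_

-- The sum a + x of a rational and a real: q < a + x iff q - a < x.
_⊕_ : ℚ → ℝ → ℝ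
a ⊕ x = pullback (_- a) (_+ a) (+-monoˡ-< (- a)) (+-monoˡ-< a)
  (λ q → solve 2 (λ q a → (q :+ a) :- a := q) refl q a)
  (λ q → solve 2 (λ q a → (q :- a) :+ a := q) refl q a) x
  where open +-*-Solver

-- The quotient x / a by a positive rational: q < x / a iff q * a < x.
_÷ᴿ_ : ℝ → (a : ℚ) .{{_ : Positive a}} → ℝ
x ÷ᴿ a = pullback (_* a) (_* a⁻¹)
  (*-monoˡ-<-pos a) (*-monoˡ-<-pos a⁻¹ {{1/pos⇒pos a}})
  (λ q → trans (*-assoc q a⁻¹ a)
               (trans (cong (q *_) (*-inverseˡ a {{pos⇒nonZero a}})) (*-identityʳ q)))
  (λ q → trans (*-assoc q a a⁻¹)
               (trans (cong (q *_) (*-inverseʳ a {{pos⇒nonZero a}})) (*-identityʳ q))) x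
  where a⁻¹ = (1/ a) {{pos⇒nonZero a}}

private
  0<* : ∀ {a b} → 0ℚ < a → 0ℚ < b → 0ℚ < a * b
  0<* {a} {b} 0<a 0<b =
    positive⁻¹ (a * b) {{pos*pos⇒pos a {{positive 0<a}} b {{positive 0<b}}}}

  0<- : ∀ {p q} → p < q → 0ℚ < q - p
  0<- {p} {q} p<q = subst (_< q - p) (+-inverseʳ p) (+-monoˡ-< (- p) p<q)

  0<-⁻¹ : ∀ {p q} → 0ℚ < q - p → p < q
  0<-⁻¹ {p} {q} h = subst₂ _<_ (+-identityˡ p)
    (solve 2 (λ p q → (q :- p) :+ p := q) refl p q) (+-monoˡ-< p h)
    where open +-*-Solver

  sq-mono : ∀ {p q} → 0ℚ ≤ p → p < q → p * p < q * q
  sq-mono {p} {q} 0≤p p<q = ≤-<-trans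
    (*-monoˡ-≤-nonNeg p {{nonNegative 0≤p}} (<⇒≤ p<q))
    (*-monoˡ-<-pos q {{positive (≤-<-trans 0≤p p<q)}} p<q)

  -- From an approximation q ≥ 0 to √N pass to r = (c q + N)/(q + c) with
  -- c = N + 1: then q² - N and r² - N have the same sign, and r lies strictly
  -- between q and √N.
  module Step (N q : ℚ) (0≤N : 0ℚ ≤ N) (0≤q : 0ℚ ≤ q) where
    open +-*-Solver

    c d i r : ℚ
    c = N + 1ℚ
    d = q + c

    0<c : 0ℚ < c
    0<c = ≤-<-trans 0≤N (q<q+1 N)

    0<d : 0ℚ < d
    0<d = subst (_< d) (+-identityʳ 0ℚ) (+-mono-≤-< 0≤q 0<c)

    d≢0 : NonZero d
    d≢0 = pos⇒nonZero d {{positive 0<d}}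

    i = (1/ d) {{d≢0}}
    r = (c * q + N) * i

    0<i : 0ℚ < i
    0<i = positive⁻¹ i {{1/pos⇒pos d {{positive 0<d}}}}

    di : d * i ≡ 1ℚ
    di = *-inverseʳ d {{d≢0}}

    N<c² : 0ℚ < c * c - N
    N<c² = subst (0ℚ <_)
      (solve 1 (λ N → (N :* N :+ N) :+ con 1ℚ := (N :+ con 1ℚ) :* (N :+ con 1ℚ) :- N) refl N)
      (≤-<-trans (+-mono-≤ {0ℚ} {N * N} {0ℚ} {N}
         (subst (_≤ N * N) (*-zeroʳ N) (*-monoˡ-≤-nonNeg N {{nonNegative 0≤N}} 0≤N)) 0≤N)
         (q<q+1 (N * N + N)))

    r-q : r - q ≡ (N - q * q) * i
    r-q = begin
      r - q             ≡⟨ cong (λ e → r - e) (sym (*-identityʳ q)) ⟩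
      r - q * 1ℚ        ≡⟨ cong (λ e → r - q * e) (sym di) ⟩
      r - q * (d * i)   ≡⟨ solve 4 (λ N q c i → (c :* q :+ N) :* i :- q :* ((q :+ c) :* i)
                              := (N :- q :* q) :* i) refl N q c i ⟩
      (N - q * q) * i   ∎
      where open ≡-Reasoning

    N-r² : N - r * r ≡ (c * c - N) * (N - q * q) * (i * i)
    N-r² = begin
      N - r * r                         ≡⟨ cong (_- r * r) (sym (trans (cong (λ e → N * (e * e)) di) (*-identityʳ N))) ⟩
      N * ((d * i) * (d * i)) - r * r   ≡⟨ solve 4 (λ N q c i →
          N :* (((q :+ c) :* i) :* ((q :+ c) :* i))
            :- ((c :* q :+ N) :* i) :* ((c :* q :+ N) :* i)
          := (c :* c :- N) :* (N :- q :* q) :* (i :* i)) refl N q c i ⟩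
      (c * c - N) * (N - q * q) * (i * i) ∎
      where open ≡-Reasoning

    up : q * q < N → q < r × r * r < N
    up h = 0<-⁻¹ (subst (0ℚ <_) (sym r-q) (0<* (0<- h) 0<i))
         , 0<-⁻¹ (subst (0ℚ <_) (sym N-r²) (0<* (0<* N<c² (0<- h)) (0<* 0<i 0<i)))

    down : 0ℚ < q → N < q * q → r < q × 0ℚ < r × N < r * r
    down 0<q h
      = 0<-⁻¹ (subst (0ℚ <_) q-r (0<* (0<- h) 0<i))
      , 0<* (subst (_< c * q + N) (+-identityʳ 0ℚ) (+-mono-<-≤ (0<* 0<c 0<q) 0≤N)) 0<i
      , 0<-⁻¹ (subst (0ℚ <_) r²-N (0<* (0<* N<c² (0<- h)) (0<* 0<i 0<i)))
      where
      q-r : (q * q - N) * i ≡ q - r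
      q-r = trans (solve 3 (λ q N i → (q :* q :- N) :* i := :- ((N :- q :* q) :* i)) refl q N i)
            (trans (cong (λ e → - e) (sym r-q)) (solve 2 (λ r q → :- (r :- q) := q :- r) refl r q))
      r²-N : (c * c - N) * (q * q - N) * (i * i) ≡ r * r - N
      r²-N = trans (solve 4 (λ q N c i → (c :* c :- N) :* (q :* q :- N) :* (i :* i)
                      := :- ((c :* c :- N) :* (N :- q :* q) :* (i :* i))) refl q N c i)
             (trans (cong (λ e → - e) (sym N-r²)) (solve 2 (λ r N → :- (N :- r :* r) := r :* r :- N) refl r N))

√_ : ℕ → ℝ
√ n = record
  { Lower           = L
  ; Upper           = U
  ; lower-inhabited = - 1ℚ , inj₁ (negative⁻¹ (- 1ℚ))
  ; upper-inhabited = N + 1ℚ , 0<c , 0<-⁻¹ N<c²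
  ; lower-closed    = closedˡ
  ; upper-closed    = λ p<q (0<p , N<p²) →
                      <-trans 0<p p<q , <-trans N<p² (sq-mono (<⇒≤ 0<p) p<q)
  ; lower-open      = openˡ
  ; upper-open      = λ {q} (0<q , N<q²) →
                      let open Step N q 0≤N (<⇒≤ 0<q)
                          r<q , 0<r , N<r² = down 0<q N<q²
                      in r , r<q , 0<r , N<r²
  ; disjoint        = λ where
                      (inj₁ q<0)  (0<q , _)  → <-asym q<0 0<q
                      (inj₂ q²<N) (_ , N<q²) → <-asym q²<N N<q²
  ; located         = loc
  }
  where
  N : ℚ
  N = ℕ→ℚ n

  L U : Pred ℚ 0ℓ
  L q = q < 0ℚ ⊎ q * q < N
  U q = 0ℚ < q × N < q * q

  0≤N : 0ℚ ≤ N
  0≤N = nonNegative⁻¹ N {{normalize-nonNeg n 1}}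

  open Step N 0ℚ 0≤N ≤-refl using (0<c; N<c²)

  closedˡ : ∀ {p q} → p < q → L q → L p
  closedˡ {p} p<q l with p <? 0ℚ
  ... | yes p<0 = inj₁ p<0
  closedˡ {p} p<q (inj₁ q<0)  | no p≮0 = inj₁ (<-trans p<q q<0)
  closedˡ {p} p<q (inj₂ q²<N) | no p≮0 = inj₂ (<-trans (sq-mono (≮⇒≥ p≮0) p<q) q²<N)

  openˡ : ∀ {p} → L p → ∃ λ q → p < q × L q
  openˡ {p} l with p <? 0ℚ
  ... | yes p<0 = let q , p<q , q<0 = <-dense p<0 in q , p<q , inj₁ q<0
  openˡ {p} (inj₁ p<0)  | no p≮0 = ⊥-elim (p≮0 p<0)
  openˡ {p} (inj₂ p²<N) | no p≮0 =
    let open Step N p 0≤N (≮⇒≥ p≮0)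
        p<r , r²<N = up p²<N
    in r , p<r , inj₂ r²<N

  loc : ∀ {p q} → p < q → L p ⊎ U q
  loc {p} p<q with p <? 0ℚ
  ... | yes p<0 = inj₁ (inj₁ p<0)
  ... | no p≮0 with p * p <? N
  ...   | yes p²<N = inj₁ (inj₂ p²<N)
  ...   | no p²≮N  = inj₂ (≤-<-trans (≮⇒≥ p≮0) p<q
                         , ≤-<-trans (≮⇒≥ p²≮N) (sq-mono (≮⇒≥ p≮0) p<q))

{-# OPTIONS --safe #-}

-- Let M be the ±1 matrix with M x y = 1 exactly when x dominates y, and let
-- f(x) = Σ_{g ∈ Γ} M g x.  Regularity gives M all column sums -1 and rows of
-- constant pairwise inner product; applying this to the all-ones vector forces
-- that product to be -1 (unless v = 1), so Σ_x f(x)² = s(v + 1) - s².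
-- Restricting x to Γ only decreases this sum of squares.  For x in Γ it is a sum
-- over triples (g, h, x) of Γ; in a transitive tournament the three cyclic
-- rotations of M g x · M h x add up to 1 on distinct g, h, x, whence
-- 3 Σ_{x ∈ Γ} f(x)² = s³ + 2s.  Comparing, s² + 3s ≤ 3v + 1, that is,
-- (2s + 3)² ≤ 13 + 12v.

module Submission where

open import Defs
open import Data.Fin.Subset using (Subset; ∣_∣)
open import Data.Nat using (ℕ; _+_; _*_)
open import Data.Rational using (-_; ℚ)
open import Relation.Binary.PropositionalEquality using (_≡_)

open import Data.Bool using (Bool; true; false; _∧_)
open import Data.Empty using (⊥-elim)
open import Data.Fin using (Fin; zero; suc; _≟_)
open import Data.Fin.Subset using (inside; outside; _∈_; _∩_)
open import Data.Fin.Subset.Properties using (∣p∣≤n)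
open import Data.Integer as ℤ using (ℤ; +_; 0ℤ; 1ℤ; -1ℤ)
import Data.Integer.Properties as ℤₚ
open import Data.Integer.Tactic.RingSolver using (solve-∀)
open import Data.Nat.Tactic.RingSolver using () renaming (solve-∀ to ℕ-solve-∀)
import Data.Nat as ℕ
import Data.Rational as ℚ
import Data.Rational.Properties as ℚₚ
import Data.Rational.Unnormalised as ℚᵘ
import Data.Rational.Unnormalised.Properties as ℚᵘₚ
import Data.Nat.Properties as ℕₚ
open import Data.Product using (_×_; _,_; proj₁; proj₂)
open import Data.Sum using (_⊎_; inj₁; inj₂)
open import Data.Vec using ([]; _∷_; lookup; tabulate)
open import Data.Vec.Properties using (lookup∘tabulate; lookup-zipWith; lookup⇒[]=)
open import Function using (_∘_; const)
open import Relation.Binary.PropositionalEquality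
  using (_≢_; refl; sym; trans; cong; cong₂; subst; module ≡-Reasoning)
open import Relation.Nullary using (Dec; yes; no; does; ¬_)
open import Relation.Nullary.Decidable using (dec-true; dec-false)
open import Algebra.Properties.Semiring.Sum ℤₚ.+-*-semiring
  using (sum; sum-cong-≗; ∑-distrib-+; ∑-comm; *-distribˡ-sum; *-distribʳ-sum)

-- Finite integer sums, plain and weighted.

private
  variable
    n : ℕ

*-swap : ∀ i j k → i ℤ.* (j ℤ.* k) ≡ j ℤ.* (i ℤ.* k)
*-swap = solve-∀

𝟙 : Bool → ℤ
𝟙 true  = 1ℤ
𝟙 false = 0ℤ

𝟙-∧ : ∀ a b → 𝟙 (a ∧ b) ≡ 𝟙 a ℤ.* 𝟙 b
𝟙-∧ true  true  = refl
𝟙-∧ true  false = refl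
𝟙-∧ false b     = refl

𝟙-idem : ∀ b → 𝟙 b ℤ.* 𝟙 b ≡ 𝟙 b
𝟙-idem true  = refl
𝟙-idem false = refl

sum-0 : ∀ n → sum {n} (const 0ℤ) ≡ 0ℤ
sum-0 ℕ.zero    = refl
sum-0 (ℕ.suc n) = trans (ℤₚ.+-identityˡ _) (sum-0 n)

sum-1 : ∀ n → sum {n} (const 1ℤ) ≡ + n
sum-1 ℕ.zero    = refl
sum-1 (ℕ.suc n) = cong (ℤ._+_ 1ℤ) (sum-1 n)

sum-linear : ∀ a (f g : Fin n → ℤ) →
             sum (λ i → a ℤ.* f i ℤ.+ g i) ≡ a ℤ.* sum f ℤ.+ sum g
sum-linear a f g = trans (∑-distrib-+ (λ i → a ℤ.* f i) g)
  (cong (λ z → z ℤ.+ sum g) (sym (*-distribˡ-sum a f)))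

sum-mono : {f g : Fin n → ℤ} → (∀ i → f i ℤ.≤ g i) → sum f ℤ.≤ sum g
sum-mono {ℕ.zero}  f≤g = ℤₚ.≤-refl
sum-mono {ℕ.suc n} f≤g = ℤₚ.+-mono-≤ (f≤g zero) (sum-mono (f≤g ∘ suc))

∣p∣≡sum : (p : Subset n) → + ∣ p ∣ ≡ sum (𝟙 ∘ lookup p)
∣p∣≡sum []            = refl
∣p∣≡sum (inside  ∷ p) = cong (ℤ._+_ 1ℤ) (∣p∣≡sum p)
∣p∣≡sum (outside ∷ p) = trans (∣p∣≡sum p) (sym (ℤₚ.+-identityˡ _))

δ : Fin n → Fin n → ℤ
δ i j = 𝟙 (does (i ≟ j))

δ-refl : (i : Fin n) → δ i i ≡ 1ℤ
δ-refl i = cong 𝟙 (dec-true (i ≟ i) refl)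

δ-≢ : {i j : Fin n} → i ≢ j → δ i j ≡ 0ℤ
δ-≢ {i = i} {j} i≢j = cong 𝟙 (dec-false (i ≟ j) i≢j)

sum-δ : (i : Fin n) (f : Fin n → ℤ) → sum (λ j → δ i j ℤ.* f j) ≡ f i
sum-δ {ℕ.suc n} zero f = trans
  (cong₂ ℤ._+_ (ℤₚ.*-identityˡ (f zero)) (sum-0 n)) (ℤₚ.+-identityʳ (f zero))
sum-δ (suc i) f = trans (ℤₚ.+-identityˡ _) (sum-δ i (f ∘ suc))

-- The weight is an arbitrary vector, so that the same laws serve the indicator of a subset and the
-- all-ones vector.
∑[_] : (Fin n → ℤ) → (Fin n → ℤ) → ℤ
∑[ w ] f = sum (λ i → w i ℤ.* f i)

∑-cong : (w : Fin n → ℤ) {f g : Fin n → ℤ} → (∀ i → f i ≡ g i) → ∑[ w ] f ≡ ∑[ w ] g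
∑-cong w f≗g = sum-cong-≗ (λ i → cong (ℤ._*_ (w i)) (f≗g i))

∑-+ : (w f g : Fin n → ℤ) → ∑[ w ] (λ i → f i ℤ.+ g i) ≡ ∑[ w ] f ℤ.+ ∑[ w ] g
∑-+ w f g = trans (sum-cong-≗ (λ i → ℤₚ.*-distribˡ-+ (w i) (f i) (g i)))
  (∑-distrib-+ (λ i → w i ℤ.* f i) (λ i → w i ℤ.* g i))

∑-*ˡ : (w : Fin n → ℤ) (a : ℤ) (f : Fin n → ℤ) →
       ∑[ w ] (λ i → a ℤ.* f i) ≡ a ℤ.* ∑[ w ] f
∑-*ˡ w a f = trans (sum-cong-≗ (λ i → *-swap (w i) a (f i)))
  (sym (*-distribˡ-sum a (λ i → w i ℤ.* f i)))

∑-*ʳ : (w : Fin n → ℤ) (f : Fin n → ℤ) (a : ℤ) →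
       ∑[ w ] (λ i → f i ℤ.* a) ≡ ∑[ w ] f ℤ.* a
∑-*ʳ w f a = trans (∑-cong w (λ i → ℤₚ.*-comm (f i) a))
  (trans (∑-*ˡ w a f) (ℤₚ.*-comm a _))

∑-const : (w : Fin n → ℤ) (a : ℤ) → ∑[ w ] (const a) ≡ sum w ℤ.* a
∑-const w a = sym (*-distribʳ-sum a w)

∑-δ : (w : Fin n → ℤ) (i : Fin n) (f : Fin n → ℤ) →
      ∑[ w ] (λ j → δ i j ℤ.* f j) ≡ w i ℤ.* f i
∑-δ w i f = trans (sum-cong-≗ (λ j → *-swap (w j) (δ i j) (f j)))
  (sum-δ i (λ j → w j ℤ.* f j))

∑-swap : (u w : Fin n → ℤ) (f : Fin n → Fin n → ℤ) →
         ∑[ u ] (λ i → ∑[ w ] (f i)) ≡ ∑[ w ] (λ j → ∑[ u ] (λ i → f i j))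
∑-swap {n} u w f = begin
  sum (λ i → u i ℤ.* sum (λ j → w j ℤ.* f i j))
    ≡⟨ sum-cong-≗ (λ i → *-distribˡ-sum {n} (u i) _) ⟩
  sum (λ i → sum (λ j → u i ℤ.* (w j ℤ.* f i j)))
    ≡⟨ ∑-comm {n} {n} _ ⟩
  sum (λ j → sum (λ i → u i ℤ.* (w j ℤ.* f i j)))
    ≡⟨ sum-cong-≗ (λ j → sum-cong-≗ (λ i → *-swap (u i) (w j) (f i j))) ⟩
  sum (λ j → sum (λ i → w j ℤ.* (u i ℤ.* f i j)))
    ≡⟨ sum-cong-≗ (λ j → *-distribˡ-sum {n} (w j) _) ⟨
  sum (λ j → w j ℤ.* sum (λ i → u i ℤ.* f i j)) ∎
  where open ≡-Reasoning

∑-sq : (w f : Fin n → ℤ) →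
       ∑[ w ] f ℤ.* ∑[ w ] f ≡ ∑[ w ] (λ g → ∑[ w ] (λ h → f g ℤ.* f h))
∑-sq w f = begin
  ∑[ w ] f ℤ.* ∑[ w ] f                     ≡⟨ ∑-*ʳ w f _ ⟨
  ∑[ w ] (λ g → f g ℤ.* ∑[ w ] f)           ≡⟨ ∑-cong w (λ g → ∑-*ˡ w (f g) f) ⟨
  ∑[ w ] (λ g → ∑[ w ] (λ h → f g ℤ.* f h)) ∎
  where open ≡-Reasoning

-- Matrices whose rows have constant norm and constant pairwise inner product.

module _ {n} (M : Fin n → Fin n → ℤ) (c d : ℤ)
         (diagonal    : ∀ g → sum (λ x → M g x ℤ.* M g x) ≡ d)
         (offDiagonal : ∀ g h → g ≢ h → sum (λ x → M g x ℤ.* M h x) ≡ c) where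

  -- The Gram matrix is cJ + (d - c)I. Writing it as one formula in `δ` lets the double sum below be
  -- evaluated by linearity, with no case split on g = h.
  gram : ∀ g h → sum (λ x → M g x ℤ.* M h x) ≡ c ℤ.+ δ g h ℤ.* (d ℤ.- c)
  gram g h with g ≟ h
  ... | yes refl = trans (diagonal g) (eq c d)
    where
    eq : ∀ c d → d ≡ c ℤ.+ 1ℤ ℤ.* (d ℤ.- c)
    eq = solve-∀
  ... | no g≢h = trans (offDiagonal g h g≢h) (sym (ℤₚ.+-identityʳ c))

  -- The left side is the squared length of the combination of rows with coefficients `w`. Expanding
  -- the square and summing over x first turns it into the quadratic form of the Gram matrix at `w`.
  sum-∑²≡ : (w : Fin n → ℤ) →
    sum (λ x → ∑[ w ] (λ g → M g x) ℤ.* ∑[ w ] (λ g → M g x))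
      ≡ sum w ℤ.* sum w ℤ.* c ℤ.+ sum (λ g → w g ℤ.* w g) ℤ.* (d ℤ.- c)
  sum-∑²≡ w = begin
    sum (λ x → ∑[ w ] (λ g → M g x) ℤ.* ∑[ w ] (λ g → M g x))
      -- The factor 1 turns the plain sum over x into a weighted one, so that `∑-swap` can carry it
      -- inwards past g and h.
      ≡⟨ sum-cong-≗ (λ x → trans (∑-sq w (λ g → M g x)) (sym (ℤₚ.*-identityˡ _))) ⟩
    ∑[ const 1ℤ ] (λ x → ∑[ w ] (λ g → ∑[ w ] (λ h → M g x ℤ.* M h x)))
      ≡⟨ ∑-swap (const 1ℤ) w _ ⟩
    ∑[ w ] (λ g → ∑[ const 1ℤ ] (λ x → ∑[ w ] (λ h → M g x ℤ.* M h x)))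
      ≡⟨ ∑-cong w (λ g → ∑-swap (const 1ℤ) w _) ⟩
    ∑[ w ] (λ g → ∑[ w ] (λ h → ∑[ const 1ℤ ] (λ x → M g x ℤ.* M h x)))
      ≡⟨ ∑-cong w (λ g → ∑-cong w (λ h →
           trans (sum-cong-≗ {n} (λ x → ℤₚ.*-identityˡ _)) (gram g h))) ⟩
    ∑[ w ] (λ g → ∑[ w ] (λ h → c ℤ.+ δ g h ℤ.* (d ℤ.- c)))
      ≡⟨ ∑-cong w (λ g → trans (∑-+ w _ _)
           (cong₂ ℤ._+_ (∑-const w c) (∑-δ w g (const (d ℤ.- c))))) ⟩
    ∑[ w ] (λ g → sum w ℤ.* c ℤ.+ w g ℤ.* (d ℤ.- c))
      ≡⟨ trans (∑-+ w _ _) (cong₂ ℤ._+_ (∑-const w _) (∑-*ʳ w w _)) ⟩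
    sum w ℤ.* (sum w ℤ.* c) ℤ.+ ∑[ w ] w ℤ.* (d ℤ.- c)
      ≡⟨ cong (λ z → z ℤ.+ ∑[ w ] w ℤ.* (d ℤ.- c)) (sym (ℤₚ.*-assoc (sum w) (sum w) c)) ⟩
    sum w ℤ.* sum w ℤ.* c ℤ.+ sum (λ g → w g ℤ.* w g) ℤ.* (d ℤ.- c) ∎
    where open ≡-Reasoning

-- Triple sums, skew sums and sums restricted to a subset.

∑³[_] : (Fin n → ℤ) → (Fin n → Fin n → Fin n → ℤ) → ℤ
∑³[ w ] F = ∑[ w ] (λ g → ∑[ w ] (λ h → ∑[ w ] (F g h)))

∑³-+ : (w : Fin n → ℤ) (F G : Fin n → Fin n → Fin n → ℤ) →
       ∑³[ w ] (λ g h x → F g h x ℤ.+ G g h x) ≡ ∑³[ w ] F ℤ.+ ∑³[ w ] G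
∑³-+ w F G = trans
  (∑-cong w (λ g → trans (∑-cong w (λ h → ∑-+ w _ _)) (∑-+ w _ _))) (∑-+ w _ _)

-- All three variables carry the same weight, so renaming them cyclically is just two interchanges
-- of summation.
∑³-rotate : (w : Fin n → ℤ) (F : Fin n → Fin n → Fin n → ℤ) →
            ∑³[ w ] (λ g h x → F h x g) ≡ ∑³[ w ] F
∑³-rotate w F = trans (∑-swap w w _) (∑-cong w (λ h → ∑-swap w w _))

-- Exchanging the two variables negates the summand, so the sum equals its own negative.
∑∑-skew : (w : Fin n → ℤ) (K : Fin n → Fin n → ℤ) →
          (∀ x y → K x y ≡ ℤ.- K y x) → ∑[ w ] (λ x → ∑[ w ] (K x)) ≡ 0ℤ
∑∑-skew w K skew = x≡-x⇒x≡0 _ (begin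
  ∑[ w ] (λ x → ∑[ w ] (K x))
    ≡⟨ ∑-swap w w K ⟩
  ∑[ w ] (λ y → ∑[ w ] (λ x → K x y))
    ≡⟨ ∑-cong w (λ y → ∑-cong w (λ x → trans (skew x y) (neg (K y x)))) ⟩
  ∑[ w ] (λ y → ∑[ w ] (λ x → -1ℤ ℤ.* K y x))
    ≡⟨ ∑-cong w (λ y → ∑-*ˡ w -1ℤ (K y)) ⟩
  ∑[ w ] (λ y → -1ℤ ℤ.* ∑[ w ] (K y))
    ≡⟨ ∑-*ˡ w -1ℤ _ ⟩
  -1ℤ ℤ.* ∑[ w ] (λ y → ∑[ w ] (K y))
    ≡⟨ neg _ ⟨
  ℤ.- ∑[ w ] (λ y → ∑[ w ] (K y)) ∎)
  where
  open ≡-Reasoning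
  neg : ∀ a → ℤ.- a ≡ -1ℤ ℤ.* a
  neg = solve-∀
  x≡-x⇒x≡0 : ∀ x → x ≡ ℤ.- x → x ≡ 0ℤ
  x≡-x⇒x≡0 (+ ℕ.zero) eq = refl
  x≡-x⇒x≡0 (+ ℕ.suc n) ()
  x≡-x⇒x≡0 (ℤ.-[1+ n ]) ()

-- Outside `p` the weight is 0. This admits identities that hold only for vertices of the transitive
-- subtournament.
∑-cong-∈ : (p : Subset n) {f g : Fin n → ℤ} → (∀ i → i ∈ p → f i ≡ g i) →
           ∑[ 𝟙 ∘ lookup p ] f ≡ ∑[ 𝟙 ∘ lookup p ] g
∑-cong-∈ p {f} {g} f≗g = sum-cong-≗ term
  where
  term : ∀ i → 𝟙 (lookup p i) ℤ.* f i ≡ 𝟙 (lookup p i) ℤ.* g i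
  term i with lookup p i in eq
  ... | inside  = cong (ℤ._*_ 1ℤ) (f≗g i (lookup⇒[]= i p eq))
  ... | outside = refl

0≤i*i : ∀ i → 0ℤ ℤ.≤ i ℤ.* i
0≤i*i (+ n)        = subst (ℤ._≤_ 0ℤ) (ℤₚ.pos-* n n) (ℤ.+≤+ ℕ.z≤n)
0≤i*i (ℤ.-[1+ n ]) = ℤ.+≤+ ℕ.z≤n

-- The terms lost by restricting to `p` are squares, hence nonnegative.
∑-sq≤sum : (p : Subset n) (f : Fin n → ℤ) →
           ∑[ 𝟙 ∘ lookup p ] (λ x → f x ℤ.* f x) ℤ.≤ sum (λ x → f x ℤ.* f x)
∑-sq≤sum p f = sum-mono λ x → term (lookup p x) (f x)
  where
  term : ∀ b a → 𝟙 b ℤ.* (a ℤ.* a) ℤ.≤ a ℤ.* a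
  term true  a = ℤₚ.≤-reflexive (ℤₚ.*-identityˡ _)
  term false a = 0≤i*i a

-- The sign matrix of a tournament and its triples inside a transitive subset.

module Signed {n} (A : Fin n → Fin n → ℤ)
  (loopless : ∀ x → A x x ≡ 0ℤ)
  (arc : ∀ x y → x ≢ y → (A x y ≡ 1ℤ × A y x ≡ 0ℤ) ⊎ (A x y ≡ 0ℤ × A y x ≡ 1ℤ))
  where

  -- `K` is the skew part of `M`, half of `M` minus its transpose: it agrees with `M` off the
  -- diagonal and is 0 on it, where `M` is -1.
  M K : Fin n → Fin n → ℤ
  M x y = + 2 ℤ.* A x y ℤ.- 1ℤ
  K x y = A x y ℤ.- A y x

  M² : ∀ x y → M x y ℤ.* M x y ≡ 1ℤ
  M² x y with x ≟ y
  ... | yes refl rewrite loopless x = refl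
  ... | no x≢y with arc x y x≢y
  ...   | inj₁ (xy , _) rewrite xy = refl
  ...   | inj₂ (xy , _) rewrite xy = refl

  rowPairing : Fin n → Fin n → Fin n → ℤ
  rowPairing g h x = M g x ℤ.* M h x

  -- The correction compensates the diagonal entries M x x = -1, which break the
  -- skew symmetry of M; being skew itself, it sums to zero over triples.
  corrected : Fin n → Fin n → Fin n → ℤ
  corrected g h x = rowPairing g h x ℤ.+ δ g h ℤ.* (+ 2 ℤ.* K x g)

  module _ (p : Subset n)
    (transitive : ∀ {x y z} → x ∈ p → y ∈ p → z ∈ p →
                  A x y ≡ 1ℤ → A y z ≡ 1ℤ → A x z ≡ 1ℤ) where

    no-3-cycle : ∀ {x y z} → x ∈ p → y ∈ p → z ∈ p →
                 A x y ≡ 1ℤ → A y z ≡ 1ℤ → A x z ≢ 0ℤ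
    no-3-cycle x∈ y∈ z∈ xy yz xz with trans (sym (transitive x∈ y∈ z∈ xy yz)) xz
    ... | ()

    -- For distinct vertices, M g x * M h x is 1 if x is the source or the sink of the triple and -1
    -- otherwise. A transitive triple has one source, one sink and one middle vertex, so the
    -- rotations add up to 1 + 1 - 1. If exactly two vertices coincide, one rotation gives a square,
    -- 1, and the other two each contain a diagonal factor -1; the correction cancels these two. If
    -- all coincide, the sum is 3 = 1 + 2.
    cyclic-sum : ∀ {g h x} → g ∈ p → h ∈ p → x ∈ p →
      corrected g h x ℤ.+ (corrected h x g ℤ.+ corrected x g h)
        ≡ 1ℤ ℤ.+ δ g h ℤ.* (δ h x ℤ.* + 2)
    cyclic-sum {g} {h} {x} g∈ h∈ x∈ = cases (g ≟ h) (h ≟ x) (x ≟ g)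
      where
      cases : Dec (g ≡ h) → Dec (h ≡ x) → Dec (x ≡ g) →
        corrected g h x ℤ.+ (corrected h x g ℤ.+ corrected x g h)
          ≡ 1ℤ ℤ.+ δ g h ℤ.* (δ h x ℤ.* + 2)
      cases (yes refl) (yes refl) _ rewrite δ-refl g | loopless g = refl
      cases (yes refl) (no h≢x) _
        rewrite δ-refl g | δ-≢ h≢x | δ-≢ (h≢x ∘ sym) | loopless g with arc g x h≢x
      ... | inj₁ (gx , xg) rewrite gx | xg = refl
      ... | inj₂ (gx , xg) rewrite gx | xg = refl
      cases (no g≢h) (yes refl) _
        rewrite δ-refl h | δ-≢ g≢h | δ-≢ (g≢h ∘ sym) | loopless h with arc g h g≢h
      ... | inj₁ (gh , hg) rewrite gh | hg = refl
      ... | inj₂ (gh , hg) rewrite gh | hg = refl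
      cases (no g≢h) (no h≢x) (yes refl)
        rewrite δ-refl g | δ-≢ g≢h | δ-≢ h≢x | loopless g with arc g h g≢h
      ... | inj₁ (gh , hg) rewrite gh | hg = refl
      ... | inj₂ (gh , hg) rewrite gh | hg = refl
      cases (no g≢h) (no h≢x) (no x≢g)
        rewrite δ-≢ g≢h | δ-≢ h≢x | δ-≢ x≢g
        with arc g h g≢h | arc h x h≢x | arc x g x≢g
      -- The cycle g, h, x: its rotations would add up to -3.
      ... | inj₁ (gh , hg) | inj₁ (hx , xh) | inj₁ (xg , gx) =
              ⊥-elim (no-3-cycle g∈ h∈ x∈ gh hx gx)
      ... | inj₁ (gh , hg) | inj₁ (hx , xh) | inj₂ (xg , gx)
              rewrite gh | hg | hx | xh | xg | gx = refl
      ... | inj₁ (gh , hg) | inj₂ (hx , xh) | inj₁ (xg , gx)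
              rewrite gh | hg | hx | xh | xg | gx = refl
      ... | inj₁ (gh , hg) | inj₂ (hx , xh) | inj₂ (xg , gx)
              rewrite gh | hg | hx | xh | xg | gx = refl
      ... | inj₂ (gh , hg) | inj₁ (hx , xh) | inj₁ (xg , gx)
              rewrite gh | hg | hx | xh | xg | gx = refl
      ... | inj₂ (gh , hg) | inj₁ (hx , xh) | inj₂ (xg , gx)
              rewrite gh | hg | hx | xh | xg | gx = refl
      ... | inj₂ (gh , hg) | inj₂ (hx , xh) | inj₁ (xg , gx)
              rewrite gh | hg | hx | xh | xg | gx = refl
      -- The opposite cycle g, x, h.
      ... | inj₂ (gh , hg) | inj₂ (hx , xh) | inj₂ (xg , gx) =
              ⊥-elim (no-3-cycle g∈ x∈ h∈ gx xh gh)

    private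
      w : Fin n → ℤ
      w = 𝟙 ∘ lookup p

      s : ℤ
      s = + ∣ p ∣

      w-idem : ∀ x → w x ℤ.* w x ≡ w x
      w-idem x = 𝟙-idem (lookup p x)

      w-absorb : ∀ x a → w x ℤ.* (w x ℤ.* a) ≡ w x ℤ.* a
      w-absorb x a = trans (sym (ℤₚ.*-assoc (w x) (w x) a)) (cong (λ z → z ℤ.* a) (w-idem x))

    ∑³-corrected : ∑³[ w ] corrected ≡ ∑³[ w ] rowPairing
    ∑³-corrected = trans (∑³-+ w rowPairing (λ g h x → δ g h ℤ.* (+ 2 ℤ.* K x g)))
      (trans (cong (ℤ._+_ (∑³[ w ] rowPairing)) vanish) (ℤₚ.+-identityʳ _))
      where
      open ≡-Reasoning
      skew : ∀ a b → + 2 ℤ.* (a ℤ.- b) ≡ ℤ.- (+ 2 ℤ.* (b ℤ.- a))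
      skew = solve-∀
      vanish : ∑³[ w ] (λ g h x → δ g h ℤ.* (+ 2 ℤ.* K x g)) ≡ 0ℤ
      vanish = begin
        ∑³[ w ] (λ g h x → δ g h ℤ.* (+ 2 ℤ.* K x g))
          ≡⟨ ∑-cong w (λ g → trans (∑-cong w (λ h → ∑-*ˡ w (δ g h) _)) (∑-δ w g _)) ⟩
        ∑[ w ] (λ g → w g ℤ.* ∑[ w ] (λ x → + 2 ℤ.* K x g))
          ≡⟨ sum-cong-≗ {n} (λ g → w-absorb g _) ⟩
        ∑[ w ] (λ g → ∑[ w ] (λ x → + 2 ℤ.* K x g))
          ≡⟨ ∑∑-skew w _ (λ g x → skew (A x g) (A g x)) ⟩
        0ℤ ∎

    -- There are s³ triples, each contributing 1, and the s constant triples contribute 2 more.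
    ∑³-cyclic : ∑³[ w ] (λ g h x → 1ℤ ℤ.+ δ g h ℤ.* (δ h x ℤ.* + 2))
                  ≡ s ℤ.* s ℤ.* s ℤ.+ s ℤ.* + 2
    ∑³-cyclic = begin
      ∑³[ w ] (λ g h x → 1ℤ ℤ.+ δ g h ℤ.* (δ h x ℤ.* + 2))
        ≡⟨ ∑³-+ w (λ _ _ _ → 1ℤ) (λ g h x → δ g h ℤ.* (δ h x ℤ.* + 2)) ⟩
      ∑³[ w ] (λ _ _ _ → 1ℤ) ℤ.+ ∑³[ w ] (λ g h x → δ g h ℤ.* (δ h x ℤ.* + 2))
        ≡⟨ cong₂ ℤ._+_ ones deltas ⟩
      S ℤ.* (S ℤ.* (S ℤ.* 1ℤ)) ℤ.+ S ℤ.* + 2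
        ≡⟨ cong (λ t → t ℤ.* (t ℤ.* (t ℤ.* 1ℤ)) ℤ.+ t ℤ.* + 2) (∣p∣≡sum p) ⟨
      s ℤ.* (s ℤ.* (s ℤ.* 1ℤ)) ℤ.+ s ℤ.* + 2
        ≡⟨ rearrange s ⟩
      s ℤ.* s ℤ.* s ℤ.+ s ℤ.* + 2 ∎
      where
      open ≡-Reasoning
      S : ℤ
      S = sum w
      rearrange : ∀ t → t ℤ.* (t ℤ.* (t ℤ.* 1ℤ)) ℤ.+ t ℤ.* + 2 ≡ t ℤ.* t ℤ.* t ℤ.+ t ℤ.* + 2
      rearrange = solve-∀
      ones : ∑³[ w ] (λ _ _ _ → 1ℤ) ≡ S ℤ.* (S ℤ.* (S ℤ.* 1ℤ))
      ones = trans
        (∑-cong w (λ _ → trans (∑-cong w (λ _ → ∑-const w 1ℤ)) (∑-const w _)))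
        (∑-const w _)
      deltas : ∑³[ w ] (λ g h x → δ g h ℤ.* (δ h x ℤ.* + 2)) ≡ S ℤ.* + 2
      deltas = begin
        ∑³[ w ] (λ g h x → δ g h ℤ.* (δ h x ℤ.* + 2))
          ≡⟨ ∑-cong w (λ g → ∑-cong w (λ h →
               trans (∑-*ˡ w (δ g h) _) (cong (ℤ._*_ (δ g h)) (∑-δ w h (const (+ 2)))))) ⟩
        ∑[ w ] (λ g → ∑[ w ] (λ h → δ g h ℤ.* (w h ℤ.* + 2)))
          ≡⟨ ∑-cong w (λ g → trans (∑-δ w g _) (w-absorb g (+ 2))) ⟩
        ∑[ w ] (λ g → w g ℤ.* + 2)
          ≡⟨ sum-cong-≗ {n} (λ g → w-absorb g (+ 2)) ⟩
        ∑[ w ] (const (+ 2))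
          ≡⟨ ∑-const w (+ 2) ⟩
        S ℤ.* + 2 ∎

    column-squares-inside :
      + 3 ℤ.* ∑[ w ] (λ x → ∑[ w ] (λ g → M g x) ℤ.* ∑[ w ] (λ g → M g x))
        ≡ s ℤ.* s ℤ.* s ℤ.+ s ℤ.* + 2
    column-squares-inside = begin
      + 3 ℤ.* ∑[ w ] (λ x → ∑[ w ] (λ g → M g x) ℤ.* ∑[ w ] (λ g → M g x))
        ≡⟨ cong (ℤ._*_ (+ 3)) (∑-cong w (λ x → ∑-sq w (λ g → M g x))) ⟩
      + 3 ℤ.* ∑³[ w ] (λ x g h → rowPairing g h x)
        ≡⟨ cong (ℤ._*_ (+ 3)) (∑³-rotate w rowPairing) ⟩
      + 3 ℤ.* ∑³[ w ] rowPairing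
        ≡⟨ cong (ℤ._*_ (+ 3)) ∑³-corrected ⟨
      + 3 ℤ.* ∑³[ w ] corrected
        ≡⟨ triple _ ⟩
      ∑³[ w ] corrected ℤ.+ (∑³[ w ] corrected ℤ.+ ∑³[ w ] corrected)
        -- One copy is left alone, one is rotated once and one twice, so that the three summands
        -- match `cyclic-sum`.
        ≡⟨ cong (ℤ._+_ (∑³[ w ] corrected)) (cong₂ ℤ._+_ (∑³-rotate w corrected)
             (trans (∑³-rotate w (λ g h x → corrected h x g)) (∑³-rotate w corrected))) ⟨
      ∑³[ w ] corrected ℤ.+
        (∑³[ w ] (λ g h x → corrected h x g) ℤ.+ ∑³[ w ] (λ g h x → corrected x g h))
        ≡⟨ cong (ℤ._+_ (∑³[ w ] corrected))
             (∑³-+ w (λ g h x → corrected h x g) (λ g h x → corrected x g h)) ⟨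
      ∑³[ w ] corrected ℤ.+ ∑³[ w ] (λ g h x → corrected h x g ℤ.+ corrected x g h)
        ≡⟨ ∑³-+ w corrected (λ g h x → corrected h x g ℤ.+ corrected x g h) ⟨
      ∑³[ w ] (λ g h x → corrected g h x ℤ.+ (corrected h x g ℤ.+ corrected x g h))
        ≡⟨ ∑-cong-∈ p (λ g g∈ → ∑-cong-∈ p (λ h h∈ → ∑-cong-∈ p (λ x x∈ →
             cyclic-sum g∈ h∈ x∈))) ⟩
      ∑³[ w ] (λ g h x → 1ℤ ℤ.+ δ g h ℤ.* (δ h x ℤ.* + 2))
        ≡⟨ ∑³-cyclic ⟩
      s ℤ.* s ℤ.* s ℤ.+ s ℤ.* + 2 ∎
      where
      open ≡-Reasoning
      triple : ∀ a → + 3 ℤ.* a ≡ a ℤ.+ (a ℤ.+ a)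
      triple = solve-∀

-- Row products and column sums of a doubly regular tournament.

module Regular {v} (G : Tournament v) (regular : DoublyRegular G) where
  open Tournament G
  open DoublyRegular regular

  A : Fin v → Fin v → ℤ
  A x y = 𝟙 (does (E? x y))

  A≡1 : ∀ {x y} → E x y → A x y ≡ 1ℤ
  A≡1 {x} {y} xy = cong 𝟙 (dec-true (E? x y) xy)

  A≡0 : ∀ {x y} → ¬ E x y → A x y ≡ 0ℤ
  A≡0 {x} {y} ¬xy = cong 𝟙 (dec-false (E? x y) ¬xy)

  A≡1⇒E : ∀ {x y} → A x y ≡ 1ℤ → E x y
  A≡1⇒E {x} {y} eq with E? x y
  ... | yes xy = xy
  A≡1⇒E {x} {y} () | no _

  A-arc : ∀ x y → x ≢ y → (A x y ≡ 1ℤ × A y x ≡ 0ℤ) ⊎ (A x y ≡ 0ℤ × A y x ≡ 1ℤ)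
  A-arc x y x≢y with exactly-one x y x≢y
  ... | inj₁ (xy , ¬yx) = inj₁ (A≡1 xy , A≡0 ¬yx)
  ... | inj₂ (yx , ¬xy) = inj₂ (A≡0 ¬xy , A≡1 yx)

  open Signed A (λ x → A≡0 (irreflexive x)) A-arc

  V : ℤ
  V = + v

  common : ℤ
  common = + proj₁ commonDominated

  double-degree : ∀ d → 1 + 2 * d ≡ v → + 2 ℤ.* + d ≡ V ℤ.- 1ℤ
  double-degree d eq = trans (shift (+ d)) (cong (λ z → z ℤ.- 1ℤ)
    (trans (cong (ℤ._+_ 1ℤ) (sym (ℤₚ.pos-* 2 d))) (cong +_ eq)))
    where
    shift : ∀ z → + 2 ℤ.* z ≡ 1ℤ ℤ.+ + 2 ℤ.* z ℤ.- 1ℤ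
    shift = solve-∀

  ∣tabulate∣ : (f : Fin v → Bool) → + ∣ tabulate f ∣ ≡ sum (𝟙 ∘ f)
  ∣tabulate∣ f = trans (∣p∣≡sum (tabulate f))
    (sum-cong-≗ (λ x → cong 𝟙 (lookup∘tabulate f x)))

  2*outdegree : ∀ g → + 2 ℤ.* sum (A g) ≡ V ℤ.- 1ℤ
  2*outdegree g = trans (cong (ℤ._*_ (+ 2)) (sym (∣tabulate∣ _)))
    (double-degree (outDegree g) (outDegree≡ g))

  2*indegree : ∀ x → + 2 ℤ.* sum (λ g → A g x) ≡ V ℤ.- 1ℤ
  2*indegree x = trans (cong (ℤ._*_ (+ 2)) (sym (∣tabulate∣ _)))
    (double-degree (inDegree x) (inDegree≡ x))

  common-outneighbours : ∀ g h → g ≢ h → sum (λ x → A g x ℤ.* A h x) ≡ common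
  common-outneighbours g h g≢h = trans
    (trans (sum-cong-≗ term) (sym (∣p∣≡sum (N⁺ g ∩ N⁺ h))))
    (cong +_ (proj₂ commonDominated g h g≢h))
    where
    term : ∀ x → A g x ℤ.* A h x ≡ 𝟙 (lookup (N⁺ g ∩ N⁺ h) x)
    term x = sym (trans (cong 𝟙 (trans (lookup-zipWith _∧_ x (N⁺ g) (N⁺ h))
      (cong₂ _∧_ (lookup∘tabulate _ x) (lookup∘tabulate _ x)))) (𝟙-∧ (does (E? g x)) (does (E? h x))))

  -- The inner product of two distinct rows of `M`: expanding (2a - 1)(2b - 1) and summing gives 4k
  -- - 2(v - 1) + v, where k is `common`. It is -1 exactly when k = (v - 3)/4.
  c : ℤ
  c = + 4 ℤ.* common ℤ.+ + 2 ℤ.- V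

  row-norm : ∀ g → sum (λ x → M g x ℤ.* M g x) ≡ V
  row-norm g = trans (sum-cong-≗ (M² g)) (sum-1 v)

  row-product : ∀ g h → g ≢ h → sum (λ x → M g x ℤ.* M h x) ≡ c
  row-product g h g≢h = begin
    sum (λ x → M g x ℤ.* M h x)
      ≡⟨ sum-cong-≗ (λ x → expand (A g x) (A h x)) ⟩
    sum (λ x → + 4 ℤ.* (A g x ℤ.* A h x) ℤ.+
                (ℤ.- + 2 ℤ.* A g x ℤ.+ (ℤ.- + 2 ℤ.* A h x ℤ.+ 1ℤ)))
      ≡⟨ sum-linear (+ 4) (λ x → A g x ℤ.* A h x) _ ⟩
    + 4 ℤ.* P ℤ.+ sum (λ x → ℤ.- + 2 ℤ.* A g x ℤ.+ (ℤ.- + 2 ℤ.* A h x ℤ.+ 1ℤ))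
      ≡⟨ cong (ℤ._+_ (+ 4 ℤ.* P)) (sum-linear (ℤ.- + 2) (A g) _) ⟩
    + 4 ℤ.* P ℤ.+ (ℤ.- + 2 ℤ.* sum (A g) ℤ.+ sum (λ x → ℤ.- + 2 ℤ.* A h x ℤ.+ 1ℤ))
      ≡⟨ cong (λ z → + 4 ℤ.* P ℤ.+ (ℤ.- + 2 ℤ.* sum (A g) ℤ.+ z))
           (sum-linear (ℤ.- + 2) (A h) (const 1ℤ)) ⟩
    + 4 ℤ.* P ℤ.+ (ℤ.- + 2 ℤ.* sum (A g) ℤ.+ (ℤ.- + 2 ℤ.* sum (A h) ℤ.+ sum {v} (const 1ℤ)))
      ≡⟨ collect P (sum (A g)) (sum (A h)) _ ⟩
    + 4 ℤ.* P ℤ.- + 2 ℤ.* sum (A g) ℤ.- + 2 ℤ.* sum (A h)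
      ℤ.+ sum {v} (const 1ℤ)
      ≡⟨ cong₂ (λ a b → a ℤ.+ b) (cong₂ (λ a b → a ℤ.- b)
           (cong₂ (λ a b → + 4 ℤ.* a ℤ.- b) (common-outneighbours g h g≢h) (2*outdegree g))
           (2*outdegree h)) (sum-1 v) ⟩
    + 4 ℤ.* common ℤ.- (V ℤ.- 1ℤ) ℤ.- (V ℤ.- 1ℤ) ℤ.+ V
      ≡⟨ simplify common V ⟩
    c ∎
    where
    open ≡-Reasoning
    P : ℤ
    P = sum (λ x → A g x ℤ.* A h x)
    expand : ∀ a b → (+ 2 ℤ.* a ℤ.- 1ℤ) ℤ.* (+ 2 ℤ.* b ℤ.- 1ℤ)
           ≡ + 4 ℤ.* (a ℤ.* b) ℤ.+ (ℤ.- + 2 ℤ.* a ℤ.+ (ℤ.- + 2 ℤ.* b ℤ.+ 1ℤ))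
    expand = solve-∀
    collect : ∀ k a b n → + 4 ℤ.* k ℤ.+ (ℤ.- + 2 ℤ.* a ℤ.+ (ℤ.- + 2 ℤ.* b ℤ.+ n))
            ≡ + 4 ℤ.* k ℤ.- + 2 ℤ.* a ℤ.- + 2 ℤ.* b ℤ.+ n
    collect = solve-∀
    simplify : ∀ k n → + 4 ℤ.* k ℤ.- (n ℤ.- 1ℤ) ℤ.- (n ℤ.- 1ℤ) ℤ.+ n
             ≡ + 4 ℤ.* k ℤ.+ + 2 ℤ.- n
    simplify = solve-∀

  -- Twice the in-degree minus v. The weight 1 is kept because `column-squares` at the all-ones
  -- vector produces this form.
  column-sum : ∀ x → ∑[ const 1ℤ ] (λ g → M g x) ≡ -1ℤ
  column-sum x = begin
    sum (λ g → 1ℤ ℤ.* (+ 2 ℤ.* A g x ℤ.- 1ℤ))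
      ≡⟨ sum-cong-≗ {v} (λ g → ℤₚ.*-identityˡ _) ⟩
    sum (λ g → + 2 ℤ.* A g x ℤ.- 1ℤ)
      ≡⟨ sum-linear (+ 2) (λ g → A g x) (const -1ℤ) ⟩
    + 2 ℤ.* sum (λ g → A g x) ℤ.+ sum {v} (const -1ℤ)
      ≡⟨ cong₂ ℤ._+_ (2*indegree x) (trans (sym (*-distribˡ-sum {v} -1ℤ (const 1ℤ)))
           (cong (ℤ._*_ -1ℤ) (sum-1 v))) ⟩
    V ℤ.- 1ℤ ℤ.+ -1ℤ ℤ.* V
      ≡⟨ simplify V ⟩
    -1ℤ ∎
    where
    open ≡-Reasoning
    simplify : ∀ n → n ℤ.- 1ℤ ℤ.+ -1ℤ ℤ.* n ≡ -1ℤ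
    simplify = solve-∀

  column-squares : (w : Fin v → ℤ) →
    sum (λ x → ∑[ w ] (λ g → M g x) ℤ.* ∑[ w ] (λ g → M g x))
      ≡ sum w ℤ.* sum w ℤ.* c ℤ.+ sum (λ g → w g ℤ.* w g) ℤ.* (V ℤ.- c)
  column-squares = sum-∑²≡ M c V row-norm row-product

  -- `column-squares` at the all-ones vector: every column sum squares to 1, so v = v²c + v(v - c),
  -- and the difference factors. The factors v and v - 1 stay, because with at most one vertex there
  -- is no pair of distinct vertices and `common` is arbitrary.
  parameters : V ℤ.* ((V ℤ.- 1ℤ) ℤ.* (c ℤ.+ 1ℤ)) ≡ 0ℤ
  parameters = begin
    V ℤ.* ((V ℤ.- 1ℤ) ℤ.* (c ℤ.+ 1ℤ))
      ≡⟨ factor V c ⟩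
    V ℤ.* V ℤ.* c ℤ.+ V ℤ.* (V ℤ.- c) ℤ.- V
      ≡⟨ cong (λ z → z ℤ.* z ℤ.* c ℤ.+ z ℤ.* (V ℤ.- c) ℤ.- V) (sum-1 v) ⟨
    sum ones ℤ.* sum ones ℤ.* c ℤ.+ sum (λ g → ones g ℤ.* ones g) ℤ.* (V ℤ.- c) ℤ.- V
      ≡⟨ cong (λ z → z ℤ.- V) (column-squares ones) ⟨
    sum (λ x → ∑[ ones ] (λ g → M g x) ℤ.* ∑[ ones ] (λ g → M g x)) ℤ.- V
      ≡⟨ cong (λ z → z ℤ.- V) (trans
           (sum-cong-≗ (λ x → cong (λ z → z ℤ.* z) (column-sum x))) (sum-1 v)) ⟩
    V ℤ.- V
      ≡⟨ ℤₚ.+-inverseʳ V ⟩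
    0ℤ ∎
    where
    open ≡-Reasoning
    ones : Fin v → ℤ
    ones = const 1ℤ
    factor : ∀ n c → n ℤ.* ((n ℤ.- 1ℤ) ℤ.* (c ℤ.+ 1ℤ))
           ≡ n ℤ.* n ℤ.* c ℤ.+ n ℤ.* (n ℤ.- c) ℤ.- n
    factor = solve-∀

  module _ (Γ : Subset v) (transitiveΓ : IsTransitiveTournament (induced E Γ)) where

    -- Three times the sum of the squares f(x)² is evaluated by triples when x ranges over `Γ` and
    -- by row products when x ranges over all vertices. `c` remains symbolic, since it is determined
    -- only when v exceeds 1.
    cubic-bound : let s = + ∣ Γ ∣ in
      s ℤ.* s ℤ.* s ℤ.+ s ℤ.* + 2 ℤ.≤ + 3 ℤ.* (s ℤ.* s ℤ.* c ℤ.+ s ℤ.* (V ℤ.- c))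
    cubic-bound = begin
      s ℤ.* s ℤ.* s ℤ.+ s ℤ.* + 2
        ≡⟨ column-squares-inside Γ transitive ⟨
      + 3 ℤ.* ∑[ w ] (λ x → ∑[ w ] (λ g → M g x) ℤ.* ∑[ w ] (λ g → M g x))
        ≤⟨ ℤₚ.*-monoˡ-≤-nonNeg (+ 3) (∑-sq≤sum Γ (λ x → ∑[ w ] (λ g → M g x))) ⟩
      + 3 ℤ.* sum (λ x → ∑[ w ] (λ g → M g x) ℤ.* ∑[ w ] (λ g → M g x))
        ≡⟨ cong (ℤ._*_ (+ 3)) (column-squares w) ⟩
      + 3 ℤ.* (sum w ℤ.* sum w ℤ.* c ℤ.+ sum (λ g → w g ℤ.* w g) ℤ.* (V ℤ.- c))
        ≡⟨ cong₂ (λ a b → + 3 ℤ.* (a ℤ.* a ℤ.* c ℤ.+ b ℤ.* (V ℤ.- c)))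
             (sym (∣p∣≡sum Γ))
             (trans (sum-cong-≗ (λ g → 𝟙-idem (lookup Γ g))) (sym (∣p∣≡sum Γ))) ⟩
      + 3 ℤ.* (s ℤ.* s ℤ.* c ℤ.+ s ℤ.* (V ℤ.- c)) ∎
      where
      open ℤₚ.≤-Reasoning
      s : ℤ
      s = + ∣ Γ ∣
      w : Fin v → ℤ
      w = 𝟙 ∘ lookup Γ
      transitive : ∀ {x y z} → x ∈ Γ → y ∈ Γ → z ∈ Γ →
                   A x y ≡ 1ℤ → A y z ≡ 1ℤ → A x z ≡ 1ℤ
      transitive x∈ y∈ z∈ xy yz = A≡1 (IsTransitiveTournament.transitive transitiveΓ
        {_ , x∈} {_ , y∈} {_ , z∈} (A≡1⇒E xy) (A≡1⇒E yz))

-- From the cubic to the quadratic inequality.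

quadratic-bound : ∀ s v c → s ℕ.≤ v →
  + v ℤ.* ((+ v ℤ.- 1ℤ) ℤ.* (c ℤ.+ 1ℤ)) ≡ 0ℤ →
  + s ℤ.* + s ℤ.* + s ℤ.+ + s ℤ.* + 2
    ℤ.≤ + 3 ℤ.* (+ s ℤ.* + s ℤ.* c ℤ.+ + s ℤ.* (+ v ℤ.- c)) →
  s * s + 3 * s ℕ.≤ 3 * v + 1
quadratic-bound ℕ.zero v c _ _ _ = ℕ.z≤n
-- For positive `s` the hypothesis `s≤v` rules out v = 0, so the factor v cancels from `param`.
quadratic-bound s@(ℕ.suc _) v@(ℕ.suc _) c s≤v param cubic
  with ℤₚ.i*j≡0⇒i≡0∨j≡0 (+ v ℤ.- 1ℤ)
         (ℤₚ.*-cancelˡ-≡ (+ v) _ 0ℤ (trans param (sym (ℤₚ.*-zeroʳ (+ v)))))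
-- Here v = 1 and `c` is unknown; s ≤ 1 alone gives s² + 3s ≤ 4 = 3v + 1.
... | inj₁ v-1≡0 = begin
  s * s + 3 * s ≤⟨ ℕₚ.+-mono-≤ (ℕₚ.*-mono-≤ s≤1 s≤1) (ℕₚ.*-monoʳ-≤ 3 s≤1) ⟩
  4             ≤⟨ ℕₚ.+-monoˡ-≤ 1 (ℕₚ.*-monoʳ-≤ 3 (ℕ.s≤s ℕ.z≤n)) ⟩
  3 * v + 1     ∎
  where
  open ℕₚ.≤-Reasoning
  s≤1 : s ℕ.≤ 1
  s≤1 = subst (s ℕ.≤_) (ℤₚ.+-injective (ℤₚ.i-j≡0⇒i≡j (+ v) 1ℤ v-1≡0)) s≤v
-- With c = -1 the cubic bound reads s(s² + 2) ≤ s * 3(v + 1 - s). Cancel the positive s, then add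
-- 3s - 2 to both sides.
... | inj₂ c+1≡0 = ℤₚ.drop‿+≤+ (begin
  + (s * s + 3 * s)
    ≡⟨ trans (ℤₚ.pos-+ (s * s) (3 * s)) (cong₂ ℤ._+_ (ℤₚ.pos-* s s) (ℤₚ.pos-* 3 s)) ⟩
  S ℤ.* S ℤ.+ + 3 ℤ.* S
    ≡⟨ lhs S ⟩
  S ℤ.* S ℤ.+ + 2 ℤ.+ (+ 3 ℤ.* S ℤ.- + 2)
    ≤⟨ ℤₚ.+-monoˡ-≤ (+ 3 ℤ.* S ℤ.- + 2)
         (ℤₚ.*-cancelˡ-≤-pos (S ℤ.* S ℤ.+ + 2) (+ 3 ℤ.* (V ℤ.+ 1ℤ ℤ.- S)) S divided) ⟩
  + 3 ℤ.* (V ℤ.+ 1ℤ ℤ.- S) ℤ.+ (+ 3 ℤ.* S ℤ.- + 2)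
    ≡⟨ rhs S V ⟩
  + 3 ℤ.* V ℤ.+ 1ℤ
    ≡⟨ trans (ℤₚ.pos-+ (3 * v) 1) (cong (λ z → z ℤ.+ 1ℤ) (ℤₚ.pos-* 3 v)) ⟨
  + (3 * v + 1) ∎)
  where
  open ℤₚ.≤-Reasoning
  S V : ℤ
  S = + s
  V = + v
  lhs : ∀ S → S ℤ.* S ℤ.+ + 3 ℤ.* S ≡ S ℤ.* S ℤ.+ + 2 ℤ.+ (+ 3 ℤ.* S ℤ.- + 2)
  lhs = solve-∀
  rhs : ∀ S V → + 3 ℤ.* (V ℤ.+ 1ℤ ℤ.- S) ℤ.+ (+ 3 ℤ.* S ℤ.- + 2) ≡ + 3 ℤ.* V ℤ.+ 1ℤ
  rhs = solve-∀
  factorˡ : ∀ S → S ℤ.* (S ℤ.* S ℤ.+ + 2) ≡ S ℤ.* S ℤ.* S ℤ.+ S ℤ.* + 2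
  factorˡ = solve-∀
  factorʳ : ∀ S V → + 3 ℤ.* (S ℤ.* S ℤ.* -1ℤ ℤ.+ S ℤ.* (V ℤ.- -1ℤ))
          ≡ S ℤ.* (+ 3 ℤ.* (V ℤ.+ 1ℤ ℤ.- S))
  factorʳ = solve-∀
  divided : S ℤ.* (S ℤ.* S ℤ.+ + 2) ℤ.≤ S ℤ.* (+ 3 ℤ.* (V ℤ.+ 1ℤ ℤ.- S))
  divided = begin
    S ℤ.* (S ℤ.* S ℤ.+ + 2)         ≡⟨ factorˡ S ⟩
    S ℤ.* S ℤ.* S ℤ.+ S ℤ.* + 2     ≤⟨ cubic ⟩
    + 3 ℤ.* (S ℤ.* S ℤ.* c ℤ.+ S ℤ.* (V ℤ.- c))
      ≡⟨ cong (λ z → + 3 ℤ.* (S ℤ.* S ℤ.* z ℤ.+ S ℤ.* (V ℤ.- z)))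
           (ℤₚ.i-j≡0⇒i≡j c -1ℤ c+1≡0) ⟩
    + 3 ℤ.* (S ℤ.* S ℤ.* -1ℤ ℤ.+ S ℤ.* (V ℤ.- -1ℤ))
      ≡⟨ factorʳ S V ⟩
    S ℤ.* (+ 3 ℤ.* (V ℤ.+ 1ℤ ℤ.- S)) ∎

-- The embedding of the naturals into the rationals.

ℕ→ℚᵘ : ℕ → ℚᵘ.ℚᵘ
ℕ→ℚᵘ n = ℚᵘ.mkℚᵘ (+ n) 0

-- `ℕ→ℚ` normalises its fraction. Passing to unnormalised fractions reduces the laws below to
-- integer facts with denominator 1.
toℚᵘ-ℕ→ℚ : ∀ n → ℚ.toℚᵘ (ℕ→ℚ n) ℚᵘ.≃ ℕ→ℚᵘ n
toℚᵘ-ℕ→ℚ n = ℚₚ.toℚᵘ-fromℚᵘ (ℕ→ℚᵘ n)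

ℕ→ℚ-+ : ∀ m n → ℕ→ℚ (m + n) ≡ ℕ→ℚ m ℚ.+ ℕ→ℚ n
ℕ→ℚ-+ m n = ℚₚ.toℚᵘ-injective (begin
  ℚ.toℚᵘ (ℕ→ℚ (m + n))                       ≈⟨ toℚᵘ-ℕ→ℚ (m + n) ⟩
  ℕ→ℚᵘ (m + n)                               ≈⟨ ℚᵘ.*≡* (distribute (+ m) (+ n)) ⟩
  ℕ→ℚᵘ m ℚᵘ.+ ℕ→ℚᵘ n                         ≈⟨ ℚᵘₚ.+-cong (toℚᵘ-ℕ→ℚ m) (toℚᵘ-ℕ→ℚ n) ⟨
  ℚ.toℚᵘ (ℕ→ℚ m) ℚᵘ.+ ℚ.toℚᵘ (ℕ→ℚ n)         ≈⟨ ℚₚ.toℚᵘ-homo-+ (ℕ→ℚ m) (ℕ→ℚ n) ⟨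
  ℚ.toℚᵘ (ℕ→ℚ m ℚ.+ ℕ→ℚ n)                   ∎)
  where
  open ℚᵘₚ.≃-Reasoning
  distribute : ∀ i j → (i ℤ.+ j) ℤ.* 1ℤ ≡ (i ℤ.* 1ℤ ℤ.+ j ℤ.* 1ℤ) ℤ.* 1ℤ
  distribute = solve-∀

ℕ→ℚ-* : ∀ m n → ℕ→ℚ (m * n) ≡ ℕ→ℚ m ℚ.* ℕ→ℚ n
ℕ→ℚ-* m n = ℚₚ.toℚᵘ-injective (begin
  ℚ.toℚᵘ (ℕ→ℚ (m * n))                       ≈⟨ toℚᵘ-ℕ→ℚ (m * n) ⟩
  ℕ→ℚᵘ (m * n)                               ≈⟨ ℚᵘ.*≡* (cong (λ z → z ℤ.* 1ℤ) (ℤₚ.pos-* m n)) ⟩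
  ℕ→ℚᵘ m ℚᵘ.* ℕ→ℚᵘ n                         ≈⟨ ℚᵘₚ.*-cong (toℚᵘ-ℕ→ℚ m) (toℚᵘ-ℕ→ℚ n) ⟨
  ℚ.toℚᵘ (ℕ→ℚ m) ℚᵘ.* ℚ.toℚᵘ (ℕ→ℚ n)         ≈⟨ ℚₚ.toℚᵘ-homo-* (ℕ→ℚ m) (ℕ→ℚ n) ⟨
  ℚ.toℚᵘ (ℕ→ℚ m ℚ.* ℕ→ℚ n)                   ∎)
  where open ℚᵘₚ.≃-Reasoning

ℕ→ℚ-mono-≤ : ∀ {m n} → m ℕ.≤ n → ℕ→ℚ m ℚ.≤ ℕ→ℚ n
ℕ→ℚ-mono-≤ {m} {n} m≤n = ℚₚ.toℚᵘ-cancel-≤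
  (ℚᵘₚ.≤-respˡ-≃ (ℚᵘₚ.≃-sym (toℚᵘ-ℕ→ℚ m)) (ℚᵘₚ.≤-respʳ-≃ (ℚᵘₚ.≃-sym (toℚᵘ-ℕ→ℚ n))
    (ℚᵘ.*≤* (ℤₚ.*-monoʳ-≤-nonNeg 1ℤ (ℤ.+≤+ m≤n)))))

p*p<q*q : ∀ {p q} → ℚ.0ℚ ℚ.≤ p → p ℚ.< q → p ℚ.* p ℚ.< q ℚ.* q
p*p<q*q {p} {q} 0≤p p<q = ℚₚ.≤-<-trans
  (ℚₚ.*-monoˡ-≤-nonNeg p {{ℚ.nonNegative 0≤p}} (ℚₚ.<⇒≤ p<q))
  (ℚₚ.*-monoˡ-<-pos q {{ℚ.positive (ℚₚ.≤-<-trans 0≤p p<q)}} p<q)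

-- The bound as a comparison of Dedekind cuts.

corollary4p6 : (v : ℕ) (G : Tournament v) → DoublyRegular G →
    (s : ℕ) (Γ : Subset v) → ∣ Γ ∣ ≡ s →
    IsTransitiveTournament (induced (Tournament.E G) Γ) →
    ℕ→ℝ s ≤ᴿ ((- ℕ→ℚ 3) ⊕ (√ (13 + 12 * v))) ÷ᴿ ℕ→ℚ 2
-- Unfolding the quotient and the sum, q is in the lower cut of the right side exactly when r = 2q +
-- 3 is in that of the root: r < 0 or r² < 13 + 12v. The natural number t = 2s + 3 is the image of s
-- under the same map.
corollary4p6 v G regular s Γ refl transitiveΓ q q<s = lower (r ℚₚ.<? ℚ.0ℚ)
  where
  open Regular G regular
  t : ℕ
  t = s * 2 + 3
  r : ℚ
  r = q ℚ.* ℕ→ℚ 2 ℚ.- (- ℕ→ℚ 3)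

  r<t : r ℚ.< ℕ→ℚ t
  r<t = subst (r ℚ.<_)
    (sym (trans (ℕ→ℚ-+ (s * 2) 3) (cong (λ z → z ℚ.+ ℕ→ℚ 3) (ℕ→ℚ-* s 2))))
    -- The closed term `- (- ℕ→ℚ 3)` computes to `ℕ→ℚ 3`, so subtracting -3 in `r` is adding 3.
    (ℚₚ.+-monoˡ-< (ℕ→ℚ 3) (ℚₚ.*-monoˡ-<-pos (ℕ→ℚ 2) q<s))

  t*t≤ : t * t ℕ.≤ 13 + 12 * v
  t*t≤ = begin
    t * t                     ≡⟨ square s ⟩
    4 * (s * s + 3 * s) + 9   ≤⟨ ℕₚ.+-monoˡ-≤ 9 (ℕₚ.*-monoʳ-≤ 4
                                   (quadratic-bound s v c (∣p∣≤n Γ) parameters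
                                     (cubic-bound Γ transitiveΓ))) ⟩
    4 * (3 * v + 1) + 9       ≡⟨ simplify v ⟩
    13 + 12 * v               ∎
    where
    open ℕₚ.≤-Reasoning
    square : ∀ s → (s * 2 + 3) * (s * 2 + 3) ≡ 4 * (s * s + 3 * s) + 9
    square = ℕ-solve-∀
    simplify : ∀ v → 4 * (3 * v + 1) + 9 ≡ 13 + 12 * v
    simplify = ℕ-solve-∀

  -- Squaring r < t requires r to be nonnegative; a negative r is in the lower cut of the root
  -- outright.
  lower : Dec (r ℚ.< ℚ.0ℚ) → r ℚ.< ℚ.0ℚ ⊎ r ℚ.* r ℚ.< ℕ→ℚ (13 + 12 * v)
  lower (yes r<0) = inj₁ r<0
  lower (no r≮0)  = inj₂ (ℚₚ.<-≤-trans (p*p<q*q (ℚₚ.≮⇒≥ r≮0) r<t)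
    (subst (ℚ._≤ ℕ→ℚ (13 + 12 * v)) (ℕ→ℚ-* t t) (ℕ→ℚ-mono-≤ t*t≤)))
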